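{- Let $k,q\ge1$ be integers and let $X$ and the partitions $E_{i,a}$ of $X$ ($i\in[k]$, $a\in[q]$) be as defined in the context. Let $S\subseteq[k]\times[q]$ with $|S|=k$. Then \[ \bigvee_{(i,a)\in S}E_{i,a}\neq\mathbf 1_X \] if and only if $S$ selects exactly one candidate from each color class, i.e. for every $i\in[k]$ there is exactly one $a\in[q]$ with $(i,a)\in S$.
   Context: Partitions of a finite set $W$ are ordered by refinement ($\pi\preceq\sigma$ iff every block of $\pi$ is contained in a block of $\sigma$); the join $\bigvee$ of a family is the finest partition coarser than all its members; $\mathbf 1_W=\{W\}$ is the one-block partition. For a graph $H$ on vertex set $W$ (isolated vertices allowed), $\mathrm{cc}(H)$ is the partition of $W$ into connected components of $H$. $[m]=\{1,\dots,m\}$. Construction (additive-shift verifier). Let $M_0=\max\{q,2^k\}$ and let $\ell$ be a prime with $M_0<\ell<2M_0$. Let $\alpha_1,\dots,\alpha_q\in\mathbb Z_\ell$ be pairwise distinct residues. Let $X=\{\bot\}\cup(2^{[k]}\times\mathbb Z_\ell)$, where $\bot$ is an extra point. For $i\in[k]$ and $a\in[q]$, $J_{i,a}$ is the graph on $X$ with exactly the following edges: (1) for every $T\subseteq[k]$, the edge between $\bot$ and $(T,0)$; (2) for every $T\subseteq[k]\setminus\{i\}$ and every $t\in\mathbb Z_\ell$, the edge between $(T,t)$ and $(T\cup\{i\},t+\alpha_a)$ (addition modulo $\ell$). Put $E_{i,a}=\mathrm{cc}(J_{i,a})$. The pair $(i,a)$ is viewed as the $a$-th candidate of the $i$-th color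 class. -}

module Defs where

open import Data.Fin using (Fin; toℕ)
open import Data.Fin.Subset using (Subset; _∈_; _∉_; _∪_; ⁅_⁆)
open import Data.Fin.Subset.Properties using (x∈⁅x⁆; x∈p∪q⁺)
open import Data.Maybe using (Maybe; just; nothing)
open import Data.Maybe.Properties using (just-injective)
open import Data.Nat using (ℕ; _+_; NonZero)
open import Data.Nat.DivMod using (_mod_)
open import Data.Nat.Primality using (Prime; prime⇒nonZero)
open import Data.Product using (∃; _×_; _,_; proj₁)
open import Data.Sum using (inj₂)
open import Data.Unit using (⊤; tt)
open import Level using (0ℓ)
open import Relation.Binary.Construct.Closure.Equivalence using (EqClosure)
import Relation.Binary.Construct.Closure.Equivalence as EqClosure
open import Relation.Binary.Construct.Closure.ReflexiveTransitive using (Star; ε; _◅_; _◅◅_; reverse)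
open import Relation.Binary.Construct.Closure.Symmetric using (SymClosure; fwd; bwd)
import Relation.Binary.Construct.Closure.Symmetric as SymClosure
open import Relation.Binary.Core using (Rel)
open import Relation.Binary.Definitions using (Symmetric; Irreflexive)
open import Relation.Binary.PropositionalEquality using (_≡_; _≢_; refl; sym; cong; subst)
open import Relation.Binary.Structures using (IsEquivalence)
open import Relation.Unary using (Pred; _⊆_; _≐_)

------------------------------------------------------------------------
-- Partitions

-- A partition is given by the relation "lies in the same block as".
-- The blocks are the (automatically nonempty) sets  block π x.
record Partition (W : Set) : Set₁ where
  field
    _∼_           : Rel W 0ℓ
    isEquivalence : IsEquivalence _∼_

  block : W → Pred W 0ℓ
  block x y = x ∼ y

open Partition public using (block)

module _ {W : Set} where

  infix 4 _≼_ _≈_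

  _≼_ : Partition W → Partition W → Set
  π ≼ σ = ∀ x → ∃ λ y → block π x ⊆ block σ y

  -- Equality of partitions: every point has the same block in both.
  _≈_ : Partition W → Partition W → Set
  π ≈ σ = ∀ x → block π x ≐ block σ x

  -- J is the join of the family E.  See joinExists for existence;
  -- uniqueness up to _≈_ is immediate.
  record IsJoin {I : Set} (E : I → Partition W) (J : Partition W) : Set₁ where
    field
      coarser : ∀ i → E i ≼ J
      finest  : ∀ σ → (∀ i → E i ≼ σ) → J ≼ σ


-- The single block is all of W (W is nonempty where this is used).
𝟏 : (W : Set) → Partition W
𝟏 W = record
  { _∼_           = λ _ _ → ⊤
  ; isEquivalence = record { refl = tt ; sym = λ _ → tt ; trans = λ _ _ → tt }
  }

joinExists : {W I : Set} (E : I → Partition W) → ∃ (IsJoin E)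
joinExists {W} {I} E = J , record { coarser = λ i x → x , λ p → fwd (i , p) ◅ ε ; finest = finest }
  where
  Step : Rel W 0ℓ
  Step x y = ∃ λ i → block (E i) x y

  J : Partition W
  J = record { _∼_ = EqClosure Step ; isEquivalence = EqClosure.isEquivalence Step }

  finest : ∀ σ → (∀ i → E i ≼ σ) → J ≼ σ
  finest σ E≼σ x = x , EqClosure.fold σ.isEquivalence step
    where
    module σ = Partition σ
    module σ≈ = IsEquivalence σ.isEquivalence

    step : ∀ {u v} → Step u v → block σ u v
    step {u} (i , p) with E≼σ i u
    ... | _ , inc = σ≈.trans (σ≈.sym (inc (IsEquivalence.refl (Partition.isEquivalence (E i))))) (inc p)

------------------------------------------------------------------------
-- Graphs

record Graph (W : Set) : Set₁ where
  field
    Adj    : Rel W 0ℓ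
    symm   : Symmetric Adj
    irrefl : Irreflexive _≡_ Adj

-- Two vertices are in the same component iff a walk joins them.
cc : {W : Set} → Graph W → Partition W
cc H = record
  { _∼_           = Star Adj
  ; isEquivalence = record { refl = ε ; sym = reverse symm ; trans = _◅◅_ }
  }
  where open Graph H

------------------------------------------------------------------------
-- The additive-shift verifier

-- [m] is Fin m, 2^[k] is Subset k, and ℤ_ℓ is Fin ℓ with addition
-- modulo ℓ.  The extra point of X is nothing.
X : ℕ → ℕ → Set
X k ℓ = Maybe (Subset k × Fin ℓ)

module _ {k q ℓ : ℕ} (ℓ-prime : Prime ℓ) (α : Fin q → Fin ℓ) where

  private
    instance
      ℓ-nonZero : NonZero ℓ
      ℓ-nonZero = prime⇒nonZero ℓ-prime

  data Edge (i : Fin k) (a : Fin q) : Rel (X k ℓ) 0ℓ where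
    base  : ∀ T → Edge i a nothing (just (T , 0 mod ℓ))
    shift : ∀ T t → i ∉ T →
            Edge i a (just (T , t)) (just (T ∪ ⁅ i ⁆ , (toℕ t + toℕ (α a)) mod ℓ))

  J : Fin k → Fin q → Graph (X k ℓ)
  J i a = record
    { Adj    = SymClosure (Edge i a)
    ; symm   = SymClosure.symmetric (Edge i a)
    ; irrefl = λ { eq (fwd e) → distinct e eq ; eq (bwd e) → distinct e (sym eq) }
    }
    where
    distinct : ∀ {x y} → Edge i a x y → x ≢ y
    distinct (base T) ()
    distinct (shift T t i∉T) eq =
      i∉T (subst (i ∈_) (sym (cong proj₁ (just-injective eq))) (x∈p∪q⁺ (inj₂ (x∈⁅x⁆ i))))

  E : Fin k → Fin q → Partition (X k ℓ)
  E i a = cc (J i a)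

{-# OPTIONS --safe #-}

-- If some class i contributes two candidates a ≠ b, then for i ∉ T the point
-- (T , t) is joined through T ∪ {i} to (T , t + d), where d = α_b − α_a is
-- invertible modulo ℓ, so every level T collapses to ⊥ and the join is 𝟏.
-- Hence a join other than 𝟏 forces at most one candidate per class, and |S| = k
-- makes it exactly one.  Conversely, if S is the graph of f, every edge of type
-- (2) preserves the potential t − Σ_{i∈T} α_{f i}.  The points (T , 0) have at
-- most 2^k < ℓ potentials, so some residue r is none of them, and
-- the points of potential r form a union of blocks that avoids ⊥.
module Submission where

open import Defs
open import Data.Bool.Properties using (∨-identityʳ)
import Data.Empty as Empty
open import Data.Fin using (Fin; zero; suc; toℕ; combine; _↑ˡ_; _↑ʳ_)
open import Data.Fin.Properties using (2↔Bool; ¬∀⟶∃¬; pigeonhole; combine-injective; toℕ<n; toℕ-fromℕ<; toℕ-injective; fromℕ<-cong)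
import Data.Fin.Properties as Fin
open import Data.Fin.Subset using (Subset; inside; outside; _∈_; _∉_; _∪_; ⁅_⁆; ∣_∣; Nonempty)
import Data.Fin.Subset as Subset
open import Data.Fin.Subset.Properties using (_∈?_; nonempty?; anySubset?; Empty-unique; ∣⊥∣≡0; ∣⁅x⁆∣≡1; x∈⁅x⁆; p⊆q⇒∣p∣≤∣q∣; ∪-identityʳ)
open import Data.Maybe using (just; nothing)
open import Data.Nat using (ℕ; zero; suc; _+_; _*_; _^_; _∸_; _⊔_; _≤_; _<_; z≤n; NonZero; >-nonZero)
open import Data.Nat.Coprimality using (Coprime; coprime-Bézout; prime⇒coprime)
import Data.Nat.Coprimality as Coprime
open import Data.Nat.DivMod using (_%_; _mod_; m%n<n; m%n%n≡m%n; %-distribˡ-+; [m+n]%n≡m%n; [m+kn]%n≡m%n; m<n⇒m%n≡m)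
open import Data.Nat.GCD using (module Bézout)
open import Data.Nat.Primality using (Prime; prime⇒nonZero)
open import Data.Nat.Properties using (_≟_; +-assoc; +-comm; +-suc; +-identityʳ; +-mono-≤; +-monoʳ-≤; +-monoˡ-≤; +-cancelʳ-≤; +-cancelˡ-≤; ≤-trans; ≤-reflexive; ≤-<-trans; <⇒≤; >⇒≢; <-cmp; m+[n∸m]≡n; m∸n+n≡m; m∸n≤m; m≤m*n; m≤n⊔m; m<n⇒0<n∸m)
open import Data.Product using (Σ; ∃; ∃!; _×_; _,_; proj₁; proj₂)
open import Data.Vec using ([]; _∷_; _++_; splitAt; here; there)
open import Data.Vec.Properties using (lookup⇒[]=; []=⇒lookup; lookup-++ˡ; lookup-++ʳ)
open import Function using (_∘_)
open import Function.Bundles using (_⇔_; mk⇔; Equivalence; Injection; Inverse)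
open import Function.Definitions using (Injective)
open import Function.Properties.Equivalence using (⇔-isEquivalence)
open import Function.Properties.Inverse using (↔-sym; ↔⇒↣)
open import Relation.Binary.Construct.Closure.ReflexiveTransitive using (ε; _◅_)
import Relation.Binary.Construct.Closure.ReflexiveTransitive as Star
open import Relation.Binary.Construct.Closure.Symmetric using (fwd; bwd)
import Relation.Binary.Construct.On as On
open import Relation.Binary.Core using (Rel)
open import Relation.Binary.Definitions using (tri<; tri≈; tri>)
open import Relation.Binary.PropositionalEquality using (_≡_; _≢_; refl; sym; trans; cong; cong₂; subst; module ≡-Reasoning)
open import Relation.Binary.Structures using (IsEquivalence)
open import Relation.Nullary using (¬_; yes; no; contradiction)
open import Level using (0ℓ)

-- Arithmetic modulo n

module _ (n : ℕ) .{{_ : NonZero n}} where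

  %-absorbˡ : ∀ x y → (x % n + y) % n ≡ (x + y) % n
  %-absorbˡ x y = begin
    (x % n + y) % n          ≡⟨ %-distribˡ-+ (x % n) y n ⟩
    (x % n % n + y % n) % n  ≡⟨ cong (λ z → (z + y % n) % n) (m%n%n≡m%n x n) ⟩
    (x % n + y % n) % n      ≡⟨ %-distribˡ-+ x y n ⟨
    (x + y) % n              ∎
    where open ≡-Reasoning

  %-+-cancelʳ : ∀ x y c → (x + c) % n ≡ (y + c) % n → x % n ≡ y % n
  %-+-cancelʳ x y c eq = begin
    x % n                        ≡⟨ complete x ⟨
    ((x + c) % n + c′) % n       ≡⟨ cong (λ z → (z + c′) % n) eq ⟩
    ((y + c) % n + c′) % n       ≡⟨ complete y ⟩
    y % n                        ∎
    where
    open ≡-Reasoning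
    -- A natural number standing in for `-c`: since `n` is positive, `c ≤ c * n`, so the subtraction
    -- is exact and `c + c′` is a multiple of `n`.
    c′ = c * n ∸ c

    complete : ∀ z → ((z + c) % n + c′) % n ≡ z % n
    complete z = begin
      ((z + c) % n + c′) % n  ≡⟨ %-absorbˡ (z + c) c′ ⟩
      (z + c + c′) % n        ≡⟨ cong (_% n) (+-assoc z c c′) ⟩
      (z + (c + c′)) % n      ≡⟨ cong (λ w → (z + w) % n) (m+[n∸m]≡n (m≤m*n c n)) ⟩
      (z + c * n) % n         ≡⟨ [m+kn]%n≡m%n z c n ⟩
      z % n                   ∎

  toℕ-mod : ∀ x → toℕ (x mod n) ≡ x % n
  toℕ-mod x = toℕ-fromℕ< (m%n<n x n)

  mod-cong : ∀ {x y} → x % n ≡ y % n → x mod n ≡ y mod n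
  mod-cong eq = fromℕ<-cong _ _ eq _ _

  toℕ%≡toℕ : (t : Fin n) → toℕ t % n ≡ toℕ t
  toℕ%≡toℕ t = m<n⇒m%n≡m (toℕ<n t)

  mod-toℕ : (t : Fin n) → toℕ t mod n ≡ t
  mod-toℕ t = toℕ-injective (trans (toℕ-mod (toℕ t)) (toℕ%≡toℕ t))

-- Finite subsets

encode : ∀ {k} → Subset k → Fin (2 ^ k)
encode []      = zero
encode (b ∷ T) = combine (Inverse.from 2↔Bool b) (encode T)

encode-injective : ∀ {k} (T U : Subset k) → encode T ≡ encode U → T ≡ U
encode-injective []      []      _  = refl
encode-injective (b ∷ T) (c ∷ U) eq
  with b≡c , T≡U ← combine-injective (Inverse.from 2↔Bool b) (encode T) (Inverse.from 2↔Bool c) (encode U) eq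
  = cong₂ _∷_ (Injection.injective (↔⇒↣ (↔-sym 2↔Bool)) b≡c) (encode-injective T U T≡U)

-- Each `T` rules out at most one residue, by cancelling `w T`. If every residue were hit, choosing
-- a `T` for each would embed `Fin n` into the `2 ^ k` subsets, against the pigeonhole principle.
missed-residue : ∀ {k} n .{{_ : NonZero n}} → 2 ^ k < n → (w : Subset k → ℕ) →
                 ∃ λ (r : Fin n) → ∀ T → (toℕ r + w T) % n ≢ 0
missed-residue {k} n 2^k<n w =
  -- `Hit` is decidable by search over all subsets, so refuting that all residues are hit yields an
  -- explicit missed one.
  let r , none = ¬∀⟶∃¬ n Hit (λ r → anySubset? (λ T → (toℕ r + w T) % n ≟ 0)) not-all-hit
  in  r , λ T eq → none (T , eq)
  where
  Hit : Fin n → Set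
  Hit r = ∃ λ (T : Subset k) → (toℕ r + w T) % n ≡ 0

  not-all-hit : ¬ (∀ r → Hit r)
  not-all-hit hit
    with r , r′ , r<r′ , eq ← pigeonhole 2^k<n (encode ∘ proj₁ ∘ hit)
    = Fin.<⇒≢ r<r′ (toℕ-injective r≡r′)
    where
    open ≡-Reasoning
    r≡r′ : toℕ r ≡ toℕ r′
    r≡r′ = begin
      toℕ r       ≡⟨ toℕ%≡toℕ n r ⟨
      toℕ r % n   ≡⟨ %-+-cancelʳ n (toℕ r) (toℕ r′) (w (proj₁ (hit r))) (begin
        (toℕ r + w (proj₁ (hit r))) % n    ≡⟨ proj₂ (hit r) ⟩
        0                                  ≡⟨ proj₂ (hit r′) ⟨
        (toℕ r′ + w (proj₁ (hit r′))) % n  ≡⟨ cong (λ T → (toℕ r′ + w T) % n) (encode-injective _ _ eq) ⟨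
        (toℕ r′ + w (proj₁ (hit r))) % n   ∎) ⟩
      toℕ r′ % n  ≡⟨ toℕ%≡toℕ n r′ ⟩
      toℕ r′      ∎

-- Exhibits a level containing `i` as the upper end of edges of type (2).
remove : ∀ {k} {i : Fin k} {T} → i ∈ T → ∃ λ U → i ∉ U × U ∪ ⁅ i ⁆ ≡ T
remove {T = _ ∷ T} here = outside ∷ T , (λ ()) , cong (inside ∷_) (∪-identityʳ T)
remove {T = b ∷ _} (there i∈T) with remove i∈T
... | U , i∉U , refl = b ∷ U , (λ { (there i∈U) → i∉U i∈U }) , cong (_∷ _) (∨-identityʳ b)

∑ : ∀ {k} → Subset k → (Fin k → ℕ) → ℕ
∑ []            f = 0
∑ (inside  ∷ T) f = ∑ T (f ∘ suc) + f zero
∑ (outside ∷ T) f = ∑ T (f ∘ suc)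

∑-insert : ∀ {k} (T : Subset k) (f : Fin k → ℕ) {i} → i ∉ T → ∑ (T ∪ ⁅ i ⁆) f ≡ ∑ T f + f i
∑-insert (inside  ∷ T) f {zero}  i∉T = contradiction here i∉T
∑-insert (outside ∷ T) f {zero}  i∉T = cong (λ U → ∑ U (f ∘ suc) + f zero) (∪-identityʳ T)
∑-insert (outside ∷ T) f {suc i} i∉T = ∑-insert T (f ∘ suc) (i∉T ∘ there)
∑-insert (inside  ∷ T) f {suc i} i∉T = begin
  ∑ (T ∪ ⁅ i ⁆) (f ∘ suc) + f zero       ≡⟨ cong (_+ f zero) (∑-insert T (f ∘ suc) (i∉T ∘ there)) ⟩
  ∑ T (f ∘ suc) + f (suc i) + f zero     ≡⟨ +-assoc (∑ T (f ∘ suc)) _ _ ⟩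
  ∑ T (f ∘ suc) + (f (suc i) + f zero)   ≡⟨ cong (∑ T (f ∘ suc) +_) (+-comm (f (suc i)) (f zero)) ⟩
  ∑ T (f ∘ suc) + (f zero + f (suc i))   ≡⟨ +-assoc (∑ T (f ∘ suc)) _ _ ⟨
  ∑ T (f ∘ suc) + f zero + f (suc i)     ∎
  where open ≡-Reasoning

-- Counting a set of pairs class by class

∣++∣ : ∀ {m n} (p : Subset m) (r : Subset n) → ∣ p ++ r ∣ ≡ ∣ p ∣ + ∣ r ∣
∣++∣ []            r = refl
∣++∣ (inside  ∷ p) r = cong suc (∣++∣ p r)
∣++∣ (outside ∷ p) r = ∣++∣ p r

∈-++⁺ˡ : ∀ {m n} (p : Subset m) (r : Subset n) {x} → x ∈ p → x ↑ˡ n ∈ p ++ r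
∈-++⁺ˡ p r {x} x∈p = lookup⇒[]= _ _ (trans (lookup-++ˡ p r x) ([]=⇒lookup x∈p))

∈-++⁺ʳ : ∀ {m n} (p : Subset m) (r : Subset n) {x} → x ∈ r → m ↑ʳ x ∈ p ++ r
∈-++⁺ʳ p r {x} x∈r = lookup⇒[]= _ _ (trans (lookup-++ʳ p r x) ([]=⇒lookup x∈r))

0<∣p∣⇒Nonempty : ∀ {n} (p : Subset n) → 0 < ∣ p ∣ → Nonempty p
0<∣p∣⇒Nonempty {n} p 0<∣p∣ with nonempty? p
... | yes ne = ne
... | no  ¬ne = contradiction (trans (cong ∣_∣ (Empty-unique ¬ne)) (∣⊥∣≡0 n)) (>⇒≢ 0<∣p∣)

subsingleton⇒∣p∣≤1 : ∀ {n} (p : Subset n) → (∀ {x y} → x ∈ p → y ∈ p → x ≡ y) → ∣ p ∣ ≤ 1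
subsingleton⇒∣p∣≤1 {n} p unique with nonempty? p
... | yes (x , x∈p) = subst (∣ p ∣ ≤_) (∣⁅x⁆∣≡1 x)
                        (p⊆q⇒∣p∣≤∣q∣ λ y∈p → subst (_∈ ⁅ x ⁆) (unique x∈p y∈p) (x∈⁅x⁆ x))
... | no  ¬ne       = subst (_≤ 1) (sym (trans (cong ∣_∣ (Empty-unique ¬ne)) (∣⊥∣≡0 n))) z≤n

AtMostOnePerClass : ∀ k q → Subset (k * q) → Set
AtMostOnePerClass k q S = ∀ (i : Fin k) {a b : Fin q} → combine i a ∈ S → combine i b ∈ S → a ≡ b

-- Induction on the classes: `combine` lists pairs class by class, so the first `q` entries of `S`
-- are class `zero` and the rest is an instance with one class fewer.
atMostOne⇒∣S∣≤k : ∀ k q S → AtMostOnePerClass k q S → ∣ S ∣ ≤ k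
atMostOne⇒∣S∣≤k zero    q [] amo = z≤n
atMostOne⇒∣S∣≤k (suc k) q S amo with splitAt q S
... | p , r , refl = subst (_≤ suc k) (sym (∣++∣ p r)) (+-mono-≤
  (subsingleton⇒∣p∣≤1 p λ x y → amo zero (∈-++⁺ˡ p r x) (∈-++⁺ˡ p r y))
  (atMostOne⇒∣S∣≤k k q r λ i x y → amo (suc i) (∈-++⁺ʳ p r x) (∈-++⁺ʳ p r y)))

-- The later classes hold at most `k` of at least `suc k` elements, so class `zero` is inhabited. It
-- holds at most one, so at least `k` remain for the induction.
atMostOne∧k≤∣S∣⇒hit : ∀ k q S → AtMostOnePerClass k q S → k ≤ ∣ S ∣ →
                      ∀ i → ∃ λ a → combine {k} {q} i a ∈ S
atMostOne∧k≤∣S∣⇒hit (suc k) q S amo k<∣S∣ with splitAt q S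
... | p , r , refl = λ where
    zero    → let a , a∈p = 0<∣p∣⇒Nonempty p 0<∣p∣ in a , ∈-++⁺ˡ p r a∈p
    (suc i) → let a , ia∈r = atMostOne∧k≤∣S∣⇒hit k q r amo-r k≤∣r∣ i in a , ∈-++⁺ʳ p r ia∈r
  where
  amo-r : AtMostOnePerClass k q r
  amo-r i x y = amo (suc i) (∈-++⁺ʳ p r x) (∈-++⁺ʳ p r y)

  k<∣p∣+∣r∣ : suc k ≤ ∣ p ∣ + ∣ r ∣
  k<∣p∣+∣r∣ = subst (suc k ≤_) (∣++∣ p r) k<∣S∣

  0<∣p∣ : 0 < ∣ p ∣
  0<∣p∣ = +-cancelʳ-≤ k 1 ∣ p ∣ (≤-trans k<∣p∣+∣r∣ (+-monoʳ-≤ ∣ p ∣ (atMostOne⇒∣S∣≤k k q r amo-r)))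

  k≤∣r∣ : k ≤ ∣ r ∣
  k≤∣r∣ = +-cancelˡ-≤ 1 k ∣ r ∣ (≤-trans k<∣p∣+∣r∣ (+-monoˡ-≤ ∣ r ∣
    (subsingleton⇒∣p∣≤1 p λ x y → amo zero (∈-++⁺ˡ p r x) (∈-++⁺ˡ p r y))))

-- Partitions of X

-- The block of `σ` containing `block π x` may be given by another representative; as `x` lies in it
-- too, `x` and `y` are related through that representative.
≼⇒∼ : ∀ {W} {π σ : Partition W} → π ≼ σ → ∀ {x y} → Partition._∼_ π x y → Partition._∼_ σ x y
≼⇒∼ {π = π} {σ} π≼σ {x} x∼y with π≼σ x
... | _ , inc = σ.trans (σ.sym (inc (IsEquivalence.refl (Partition.isEquivalence π)))) (inc x∼y)
  where module σ = IsEquivalence (Partition.isEquivalence σ)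

module _ {k q ℓ : ℕ} (ℓ-prime : Prime ℓ) (α : Fin q → Fin ℓ) where

  private
    instance
      ℓ-nonZero : NonZero ℓ
      ℓ-nonZero = prime⇒nonZero ℓ-prime

  E-finest : ∀ i a (σ : Partition (X k ℓ)) →
             (∀ {x y} → Edge ℓ-prime α i a x y → Partition._∼_ σ x y) → E ℓ-prime α i a ≼ σ
  E-finest i a σ edge x = x , Star.fold _ (λ { (fwd e) p → σ.trans (edge e) p ; (bwd e) p → σ.trans (σ.sym (edge e)) p }) σ.refl
    where module σ = IsEquivalence (Partition.isEquivalence σ)

  -- Two candidates of the same class

  module _ {_∼_ : Rel (X k ℓ) 0ℓ} (∼-equiv : IsEquivalence _∼_) where

    private module ∼ = IsEquivalence ∼-equiv

    -- Indexing by natural numbers lets shifts accumulate by ordinary addition, with reduction only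
    -- inside `mod`.
    point : Subset k → ℕ → X k ℓ
    point T n = just (T , n mod ℓ)

    shift-point : ∀ {i a} → (∀ {x y} → Edge ℓ-prime α i a x y → x ∼ y) →
                  ∀ {T} → i ∉ T → ∀ n → point T n ∼ point (T ∪ ⁅ i ⁆) (n + toℕ (α a))
    shift-point {i} {a} edge {T} i∉T n =
      subst (λ t → point T n ∼ just (T ∪ ⁅ i ⁆ , t))
        (mod-cong ℓ (trans (cong (λ z → (z + toℕ (α a)) % ℓ) (toℕ-mod ℓ n)) (%-absorbˡ ℓ n _)))
        (edge (shift T (n mod ℓ) i∉T))

    -- Ordering the representatives makes `d` a natural number strictly between 0 and `ℓ`, hence
    -- coprime to the prime `ℓ`.
    collapse-< : ∀ {i a b} → toℕ (α a) < toℕ (α b) →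
                 (∀ {x y} → Edge ℓ-prime α i a x y → x ∼ y) →
                 (∀ {x y} → Edge ℓ-prime α i b x y → x ∼ y) →
                 ∀ x → x ∼ nothing
    collapse-< {i} {a} {b} a<b edge-a edge-b = all
      where
      d = toℕ (α b) ∸ toℕ (α a)

      d-coprime-ℓ : Coprime d ℓ
      d-coprime-ℓ = Coprime.sym (prime⇒coprime ℓ-prime {{>-nonZero (m<n⇒0<n∸m a<b)}}
                      (≤-<-trans (m∸n≤m _ (toℕ (α a))) (toℕ<n (α b))))

      module _ {T} (i∉T : i ∉ T) where

        -- Up along the `b`-edge and down along the `a`-edge: `m + α b = (m + d) + α a`.
        period : ∀ m → point T m ∼ point T (m + d)
        period m = ∼.trans (shift-point edge-b i∉T m)
          (∼.sym (subst (λ z → point T (m + d) ∼ point (T ∪ ⁅ i ⁆) z)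
            (trans (+-assoc m d _) (cong (m +_) (m∸n+n≡m (<⇒≤ a<b))))
            (shift-point edge-a i∉T (m + d))))

        multiple : ∀ j m → point T m ∼ point T (m + j * d)
        multiple zero    m = ∼.reflexive (cong (point T) (sym (+-identityʳ m)))
        multiple (suc j) m = ∼.trans (period m)
          (subst (λ z → point T (m + d) ∼ point T z) (+-assoc m d (j * d)) (multiple j (m + d)))

        step : ∀ m → point T m ∼ point T (suc m)
        -- Either `1 + y * ℓ = x * d`, and `x` jumps lead from `m` to `suc m`; or
        -- `1 + x * d = y * ℓ`, and `x` jumps lead from `suc m` back to `m`.
        step m with coprime-Bézout d-coprime-ℓ
        ... | Bézout.+- x y eq = subst (λ t → point T m ∼ just (T , t))
          (mod-cong ℓ (trans (cong (λ z → (m + z) % ℓ) (sym eq)) (trans (cong (_% ℓ) (+-suc m _)) ([m+kn]%n≡m%n (suc m) y ℓ))))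
          (multiple x m)
        ... | Bézout.-+ x y eq = ∼.sym (subst (λ t → point T (suc m) ∼ just (T , t))
          (mod-cong ℓ (trans (cong (_% ℓ) (trans (sym (+-suc m _)) (cong (m +_) eq))) ([m+kn]%n≡m%n m y ℓ)))
          (multiple x (suc m)))

        ∉-collapse : ∀ m → point T m ∼ nothing
        ∉-collapse zero    = ∼.sym (edge-a (base T))
        ∉-collapse (suc m) = ∼.trans (∼.sym (step m)) (∉-collapse m)

      point-collapse : ∀ T m → point T m ∼ nothing
      point-collapse T m with i ∈? T
      ... | no  i∉T = ∉-collapse i∉T m
      ... | yes i∈T with remove i∈T
      -- Descend along an `a`-edge to level `U`, which avoids `i`; `m + (ℓ ∸ α a)` represents
      -- `m - α a`.
      ...   | U , i∉U , refl = ∼.trans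
        (∼.sym (subst (λ t → point U (m + (ℓ ∸ toℕ (α a))) ∼ just (U ∪ ⁅ i ⁆ , t))
          (mod-cong ℓ (trans
            (cong (_% ℓ) (trans (+-assoc m _ _) (cong (m +_) (m∸n+n≡m (<⇒≤ (toℕ<n (α a)))))))
            ([m+n]%n≡m%n m ℓ)))
          (shift-point edge-a i∉U _)))
        (∉-collapse i∉U _)

      all : ∀ x → x ∼ nothing
      all nothing        = ∼.refl
      all (just (T , t)) = subst (λ u → just (T , u) ∼ nothing) (mod-toℕ ℓ t) (point-collapse T (toℕ t))

    collapse : ∀ {i a b} → α a ≢ α b →
               (∀ {x y} → Edge ℓ-prime α i a x y → x ∼ y) →
               (∀ {x y} → Edge ℓ-prime α i b x y → x ∼ y) →
               ∀ x → x ∼ nothing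
    collapse {a = a} {b} a≢b edge-a edge-b with <-cmp (toℕ (α a)) (toℕ (α b))
    ... | tri< a<b _ _ = collapse-< a<b edge-a edge-b
    ... | tri≈ _ a≡b _ = contradiction (toℕ-injective a≡b) a≢b
    ... | tri> _ _ b<a = collapse-< b<a edge-b edge-a

  -- One candidate per class

  module _ (f : Fin k → Fin q) where

    weight : Subset k → ℕ
    weight T = ∑ T (toℕ ∘ α ∘ f)

    -- Potential r, written as t ≡ r + Σ_{i∈T} α_{f i} to avoid subtraction.
    HasPotential : Fin ℓ → X k ℓ → Set
    HasPotential r nothing        = Empty.⊥
    HasPotential r (just (T , t)) = toℕ t ≡ (toℕ r + weight T) % ℓ

    -- Logical equivalence separates the points of potential `r` from all others, `nothing` being
    -- among the others.
    potentialPartition : Fin ℓ → Partition (X k ℓ)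
    potentialPartition r = record
      { _∼_           = λ x y → HasPotential r x ⇔ HasPotential r y
      ; isEquivalence = On.isEquivalence (HasPotential r) ⇔-isEquivalence
      }

    -- Both ends of a base edge lack potential `r`: `nothing` by definition, `(T , 0)` because `r`
    -- is missed. A shift edge adds the same `α (f i)` to `t` and to the weight, and cancelling it
    -- gives the converse.
    edge-preserves : ∀ r → (∀ T → (toℕ r + weight T) % ℓ ≢ 0) → ∀ {i x y} →
                     Edge ℓ-prime α i (f i) x y → HasPotential r x ⇔ HasPotential r y
    edge-preserves r missed (base T) =
      mk⇔ (λ ()) λ eq → missed T (sym (trans (sym (trans (toℕ-mod ℓ 0) (m<n⇒m%n≡m 0<ℓ))) eq))
      where 0<ℓ = ≤-<-trans z≤n (toℕ<n r)
    edge-preserves r missed {i} (shift T t i∉T) = mk⇔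
      (λ eq → begin
        toℕ ((toℕ t + c) mod ℓ)             ≡⟨ toℕ-mod ℓ _ ⟩
        (toℕ t + c) % ℓ                     ≡⟨ cong (λ z → (z + c) % ℓ) eq ⟩
        ((toℕ r + weight T) % ℓ + c) % ℓ    ≡⟨ %-absorbˡ ℓ _ c ⟩
        (toℕ r + weight T + c) % ℓ          ≡⟨ insert ⟨
        (toℕ r + weight (T ∪ ⁅ i ⁆)) % ℓ    ∎)
      (λ eq → begin
        toℕ t                     ≡⟨ toℕ%≡toℕ ℓ t ⟨
        toℕ t % ℓ                 ≡⟨ %-+-cancelʳ ℓ (toℕ t) _ c (trans (sym (toℕ-mod ℓ _)) (trans eq insert)) ⟩
        (toℕ r + weight T) % ℓ    ∎)
      where
      open ≡-Reasoning
      c = toℕ (α (f i))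

      insert : (toℕ r + weight (T ∪ ⁅ i ⁆)) % ℓ ≡ (toℕ r + weight T + c) % ℓ
      insert = cong (_% ℓ) (trans (cong (toℕ r +_) (∑-insert T _ i∉T)) (sym (+-assoc (toℕ r) _ _)))

corollary3p5 : (k q : ℕ) → 1 ≤ k → 1 ≤ q →
    (ℓ : ℕ) (ℓ-prime : Prime ℓ) → q ⊔ 2 ^ k < ℓ → ℓ < 2 * (q ⊔ 2 ^ k) →
    (α : Fin q → Fin ℓ) → Injective _≡_ _≡_ α →
    (S : Subset (k * q)) → ∣ S ∣ ≡ k →
    (⋁E : Partition (X k ℓ)) →
    IsJoin {I = Σ (Fin k × Fin q) λ (i , a) → combine i a ∈ S} (λ ((i , a) , _) → E ℓ-prime α i a) ⋁E →
    (¬ (⋁E ≈ 𝟏 (X k ℓ))) ⇔ (∀ (i : Fin k) → ∃! _≡_ (λ (a : Fin q) → combine i a ∈ S))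
corollary3p5 k q _ _ ℓ ℓ-prime M₀<ℓ _ α α-injective S ∣S∣≡k ⋁E join = mk⇔ select separate
  where
  open Partition ⋁E using (_∼_; isEquivalence)
  module ∼ = IsEquivalence isEquivalence
  module join = IsJoin join

  edge-∼ : ∀ {i a} → combine i a ∈ S → ∀ {x y} → Edge ℓ-prime α i a x y → x ∼ y
  edge-∼ {i} {a} ia∈S e = ≼⇒∼ {π = E ℓ-prime α i a} {⋁E} (join.coarser ((i , a) , ia∈S)) (fwd e ◅ ε)

  select : ¬ (⋁E ≈ 𝟏 (X k ℓ)) → ∀ i → ∃! _≡_ (λ a → combine i a ∈ S)
  select ⋁E≉𝟏 i =
    let a , ia∈S = atMostOne∧k≤∣S∣⇒hit k q S amo (≤-reflexive (sym ∣S∣≡k)) i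
    in  a , ia∈S , amo i ia∈S
    where
    amo : AtMostOnePerClass k q S
    amo i {a} {b} ia∈S ib∈S with a Fin.≟ b
    ... | yes a≡b = a≡b
    -- Two distinct candidates would put every point into the block of `nothing`, making the join
    -- `𝟏`.
    ... | no  a≢b = contradiction (λ x → _ , λ {y} _ → ∼.trans (collapsed x) (∼.sym (collapsed y))) ⋁E≉𝟏
      where collapsed = collapse ℓ-prime α isEquivalence (a≢b ∘ α-injective) (edge-∼ ia∈S) (edge-∼ ib∈S)

  separate : (∀ i → ∃! _≡_ (λ a → combine i a ∈ S)) → ¬ (⋁E ≈ 𝟏 (X k ℓ))
  -- A one-block join would relate `nothing` to the point `v mod ℓ` over the empty set, hence so
  -- would `σ`. That point has potential `r`, so `nothing` would have it too.
  separate sel ⋁E≈𝟏 = Equivalence.from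
    (≼⇒∼ {π = ⋁E} {σ} (join.finest σ E≼σ) (proj₂ (⋁E≈𝟏 nothing) {just (Subset.⊥ , v mod ℓ)} _))
    (toℕ-mod ℓ v)
    where
    instance
      ℓ-nonZero : NonZero ℓ
      ℓ-nonZero = prime⇒nonZero ℓ-prime

    f : Fin k → Fin q
    f i = proj₁ (sel i)

    missed = missed-residue ℓ (≤-<-trans (m≤n⊔m q (2 ^ k)) M₀<ℓ) (weight ℓ-prime α f)
    r = proj₁ missed
    -- The weight of the empty set is kept unevaluated so that the potential equation is exactly
    -- `toℕ-mod`.
    v = toℕ r + weight ℓ-prime α f Subset.⊥
    σ = potentialPartition ℓ-prime α f r

    E≼σ : ∀ (((i , a) , _) : Σ (Fin k × Fin q) λ (i , a) → combine i a ∈ S) → E ℓ-prime α i a ≼ σ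
    -- Uniqueness of the selected candidate identifies `a` with `f i`.
    E≼σ ((i , a) , ia∈S) with refl ← proj₂ (proj₂ (sel i)) ia∈S =
      E-finest ℓ-prime α i (f i) σ (edge-preserves ℓ-prime α f r (proj₂ missed))
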